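{- The flattening operator $\mathsf F$ increases the expressive power of unary inclusion logic $\mathrm{FO}(\subseteq_1)$; that is, there is a formula of $\mathrm{FO}(\subseteq_1,\mathsf F)$ that is not equivalent to any formula of $\mathrm{FO}(\subseteq_1)$.
   Context: A team $X$ over a model $\mathfrak M$ with non-empty domain $M$ is a set of assignments $s:\mathrm{dom}(X)\to M$ with a common set of variables $\mathrm{dom}(X)$. $s[m/v]$ is the assignment sending $v$ to $m$ and agreeing with $s$ otherwise; $X[M/v]=\{s[m/v]: s\in X, m\in M\}$; for $H:X\to\mathcal P(M)\setminus\{\varnothing\}$, $X[H/v]=\{s[m/v]: s\in X, m\in H(s)\}$. $\mathrm{FO}(\subseteq_1)$-formulas are built from first-order literals and unary inclusion atoms $t_1\subseteq t_2$ ($t_1,t_2$ single terms) using $\land,\lor,\exists,\forall$; $\mathrm{FO}(\subseteq_1,\mathsf F)$ additionally allows the unary operator $\mathsf F$. Team semantics: - literals: $\mathfrak M\models_X\alpha$ iff $\mathfrak M\models_s\alpha$ (Tarski) for all $s\in X$; - $\mathfrak M\models_X t_1\subseteq t_2$ iff for all $s\in X$ there is $s'\in X$ with $s(t_1)=s'(t_2)$; - $\mathfrak M\models_X\psi_1\lor\psi_2$ iff $X=Y\cup Z$ for some (not necessarily disjoint) $Y,Z$ with $\mathfrak M\models_Y\psi_1$, $\mathfrak M\models_Z\psi_2$; - $\mathfrak M\models_X\psi_1\land\psi_2$ iff $\mathfrak M\models_X\psi_1$ and $\mathfrak M\models_X\psi_2$; - $\mathfrak M\models_X\exists v\psi$ iff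 $\mathfrak M\models_{X[H/v]}\psi$ for some $H:X\to\mathcal P(M)\setminus\{\varnothing\}$; - $\mathfrak M\models_X\forall v\psi$ iff $\mathfrak M\models_{X[M/v]}\psi$; - $\mathfrak M\models_X\mathsf F\psi$ iff $\mathfrak M\models_{\{s\}}\psi$ for all $s\in X$. Two formulas are equivalent if they are satisfied by the same models $\mathfrak M$ and teams $X$ over $\mathfrak M$ (whose domain contains the free variables of both). -}

module Defs where

open import Level using (0ℓ; Lift; suc)
open import Data.Nat using (ℕ; _≟_)
open import Data.Product using (Σ-syntax; ∃-syntax; _×_; _,_)
open import Data.Sum using (_⊎_; inj₁; inj₂; [_,_]′)
open import Data.Vec using (Vec; []; _∷_)
open import Data.Vec.Relation.Unary.Any using (Any; here; there)
open import Function using (_∘_; id; _⇔_)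
open import Relation.Binary using (_Respects_)
open import Relation.Binary.PropositionalEquality using (_≡_; _≢_; refl; sym; trans)
open import Relation.Nullary using (¬_; yes; no; contradiction)
open import Relation.Unary using (Pred; _∈_; _⊆_; _∪_; ｛_｝; Satisfiable)

Var : Set
Var = ℕ

-- Function and relation symbols are indexed by their arity.
record Signature : Set₁ where
  field
    Fun : ℕ → Set
    Rel : ℕ → Set

open Signature public

record Structure (σ : Signature) : Set₁ where
  field
    Carrier : Set
    point   : Carrier    -- domains are non-empty
    ⟦fun⟧   : ∀ {n} → Fun σ n → Vec Carrier n → Carrier
    ⟦rel⟧   : ∀ {n} → Rel σ n → Vec Carrier n → Set

open Structure public

data Term (σ : Signature) : Set where
  var : Var → Term σ
  fun : ∀ {n} → Fun σ n → Vec (Term σ) n → Term σ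

data Literal (σ : Signature) : Set where
  _≐_ _≐̸_  : Term σ → Term σ → Literal σ
  rel ¬rel : ∀ {n} → Rel σ n → Vec (Term σ) n → Literal σ

data Logic : Set where
  FO⊆₁ FO⊆₁F : Logic

-- The two logics share all constructors except the flattening operator 𝖥,
-- which exists only in FO⊆₁F.
data Formula (σ : Signature) : Logic → Set where
  lit     : ∀ {L} → Literal σ → Formula σ L
  _⊆ⁱ_    : ∀ {L} → Term σ → Term σ → Formula σ L
  _∧ᶠ_    : ∀ {L} → Formula σ L → Formula σ L → Formula σ L
  _∨ᶠ_    : ∀ {L} → Formula σ L → Formula σ L → Formula σ L
  ∃ᶠ ∀ᶠ   : ∀ {L} → Var → Formula σ L → Formula σ L
  𝖥       : Formula σ FO⊆₁F → Formula σ FO⊆₁F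

module _ {σ : Signature} where

  data _∈ᵗ_ (v : Var) : Term σ → Set where
    self : v ∈ᵗ var v
    arg  : ∀ {n} {f : Fun σ n} {ts : Vec (Term σ) n} →
           Any (v ∈ᵗ_) ts → v ∈ᵗ fun f ts

  FVᵗ : Term σ → Pred Var 0ℓ
  FVᵗ t v = v ∈ᵗ t

  FV* : ∀ {n} → Vec (Term σ) n → Pred Var 0ℓ
  FV* ts v = Any (v ∈ᵗ_) ts

  FVˡ : Literal σ → Pred Var 0ℓ
  FVˡ (t ≐ u)     = FVᵗ t ∪ FVᵗ u
  FVˡ (t ≐̸ u)     = FVᵗ t ∪ FVᵗ u
  FVˡ (rel R ts)  = FV* ts
  FVˡ (¬rel R ts) = FV* ts

  FV : ∀ {L} → Formula σ L → Pred Var 0ℓ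
  FV (lit α)  = FVˡ α
  FV (t ⊆ⁱ u) = FVᵗ t ∪ FVᵗ u
  FV (φ ∧ᶠ ψ) = FV φ ∪ FV ψ
  FV (φ ∨ᶠ ψ) = FV φ ∪ FV ψ
  FV (∃ᶠ v φ) w = w ∈ FV φ × v ≢ w
  FV (∀ᶠ v φ) w = w ∈ FV φ × v ≢ w
  FV (𝖥 φ)    = FV φ

under-binder : ∀ {P D : Pred Var 0ℓ} {v} →
               (λ w → w ∈ P × v ≢ w) ⊆ D → P ⊆ D ∪ ｛ v ｝
under-binder {v = v} p {w} w∈P with v ≟ w
... | yes v≡w = inj₂ v≡w
... | no  v≢w = inj₁ (p (w∈P , v≢w))

-- Functions from the set of variables D to M.  The membership proof is
-- irrelevant, so that the value at v depends on v alone.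
Assignment : Set → Pred Var 0ℓ → Set
Assignment M D = ∀ v → .(v ∈ D) → M

-- Equality of assignments as functions; in the absence of function
-- extensionality it replaces _≡_ wherever sets of assignments are formed.
infix 4 _≈_
_≈_ : ∀ {M D} → Assignment M D → Assignment M D → Set
_≈_ {D = D} s t = ∀ v → .(p : v ∈ D) → s v p ≡ t v p

-- v may already belong to D, in which case its old value is overwritten.
_[_/_] : ∀ {M D} → Assignment M D → M → (v : Var) → Assignment M (D ∪ ｛ v ｝)
(s [ m / v ]) w p with v ≟ w
... | yes _   = m
... | no  v≢w = s w ([ id , (λ v≡w → contradiction v≡w v≢w) ]′ p)

record Team (M : Set) (D : Pred Var 0ℓ) : Set₁ where
  field
    member : Pred (Assignment M D) 0ℓ
    resp   : member Respects _≈_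

open Team public

infix 4 _∈ᵀ_
_∈ᵀ_ : ∀ {M D} → Assignment M D → Team M D → Set
s ∈ᵀ X = member X s

≈-trans : ∀ {M D} {s t u : Assignment M D} → s ≈ t → t ≈ u → s ≈ u
≈-trans e f v p = trans (e v p) (f v p)

≈-sym : ∀ {M D} {s t : Assignment M D} → s ≈ t → t ≈ s
≈-sym e v p = sym (e v p)

singleton : ∀ {M D} → Assignment M D → Team M D
singleton s .member t     = t ≈ s
singleton s .resp t≈u t≈s = ≈-trans (≈-sym t≈u) t≈s

IsUnion : ∀ {M D} → Team M D → Team M D → Team M D → Set
IsUnion X Y Z = ∀ s → s ∈ᵀ X ⇔ (s ∈ᵀ Y ⊎ s ∈ᵀ Z)

-- Functions X → 𝒫(M) ∖ {∅}.  They are given on all assignments, but the values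
-- outside X are unconstrained and never used.
record Supplement {M D} (X : Team M D) : Set₁ where
  field
    choice   : Assignment M D → Pred M 0ℓ
    coherent : ∀ {s t} → s ∈ᵀ X → s ≈ t → choice s ⊆ choice t
    nonempty : ∀ {s} → s ∈ᵀ X → Satisfiable (choice s)

open Supplement public

supplement : ∀ {M D} (X : Team M D) → Supplement X → (v : Var) → Team M (D ∪ ｛ v ｝)
supplement X H v .member t = ∃[ s ] ∃[ m ] s ∈ᵀ X × m ∈ choice H s × t ≈ s [ m / v ]
supplement X H v .resp t≈u (s , m , s∈X , m∈H , e) =
  s , m , s∈X , m∈H , ≈-trans (≈-sym t≈u) e

duplicate : ∀ {M D} → Team M D → (v : Var) → Team M (D ∪ ｛ v ｝)
duplicate X v .member t = ∃[ s ] ∃[ m ] s ∈ᵀ X × t ≈ s [ m / v ]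
duplicate X v .resp t≈u (s , m , s∈X , e) =
  s , m , s∈X , ≈-trans (≈-sym t≈u) e

module _ {σ : Signature} (𝔐 : Structure σ) where

  private M = Carrier 𝔐

  mutual
    eval : ∀ {D} → Assignment M D → (t : Term σ) → .(FVᵗ t ⊆ D) → M
    eval s (var v)    p = s v (p self)
    eval s (fun f ts) p = ⟦fun⟧ 𝔐 f (eval* s ts (λ q → p (arg q)))

    eval* : ∀ {D n} → Assignment M D → (ts : Vec (Term σ) n) → .(FV* ts ⊆ D) → Vec M n
    eval* s []       p = []
    eval* s (t ∷ ts) p = eval s t (λ q → p (here q)) ∷ eval* s ts (λ q → p (there q))

  Satˡ : ∀ {D} → Assignment M D → (α : Literal σ) → .(FVˡ α ⊆ D) → Set
  Satˡ s (t ≐ u)     p = eval s t (p ∘ inj₁) ≡ eval s u (p ∘ inj₂)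
  Satˡ s (t ≐̸ u)     p = eval s t (p ∘ inj₁) ≢ eval s u (p ∘ inj₂)
  Satˡ s (rel R ts)  p = ⟦rel⟧ 𝔐 R (eval* s ts p)
  Satˡ s (¬rel R ts) p = ¬ ⟦rel⟧ 𝔐 R (eval* s ts p)

  Sat : ∀ {L D} → Team M D → (φ : Formula σ L) → .(FV φ ⊆ D) → Set₁
  Sat {D = D} X (lit α) p = ∀ (s : Assignment M D) → s ∈ᵀ X → Lift (suc 0ℓ) (Satˡ s α p)
  Sat X (t ⊆ⁱ u) p = ∀ s → s ∈ᵀ X → Lift (suc 0ℓ) (∃[ s′ ] s′ ∈ᵀ X ×
                       eval s t (p ∘ inj₁) ≡ eval s′ u (p ∘ inj₂))
  Sat X (φ ∧ᶠ ψ) p = Sat X φ (p ∘ inj₁) × Sat X ψ (p ∘ inj₂)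
  Sat X (φ ∨ᶠ ψ) p = ∃[ Y ] ∃[ Z ] IsUnion X Y Z ×
                       Sat Y φ (p ∘ inj₁) × Sat Z ψ (p ∘ inj₂)
  Sat X (∃ᶠ v φ) p = Σ[ H ∈ Supplement X ] Sat (supplement X H v) φ (under-binder p)
  Sat X (∀ᶠ v φ) p = Sat (duplicate X v) φ (under-binder p)
  Sat X (𝖥 φ)    p = ∀ s → s ∈ᵀ X → Sat (singleton s) φ p

Equivalent : ∀ {σ L L′} → Formula σ L → Formula σ L′ → Set₁
Equivalent {σ} φ ψ =
  ∀ (𝔐 : Structure σ) (D : Pred Var 0ℓ) (p : FV φ ⊆ D) (q : FV ψ ⊆ D)
    (X : Team (Carrier 𝔐) D) → Sat 𝔐 X φ p ⇔ Sat 𝔐 X ψ q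

{-# OPTIONS --safe #-}

-- Take ℤ × ℤ, a disjoint union of two-way infinite paths, on which the
-- translations act transitively.  On a single assignment, "there is an infinite
-- path from y avoiding x" is expressible with unary inclusion atoms, so its
-- flattening separates the team of all x = y + (1 , 0), on distinct paths, from
-- the team of all x = y + (0 , n).  Formulas without 𝖥 do not separate these
-- teams for large n: play the Ehrenfeucht–Fraïssé game for the successor relation
-- (whose positions compare distances up to a bound that halves with each
-- quantifier) between teams instead of assignments.  The inclusion atoms t₁ ⊆ t₂
-- survive because the second team stays closed under translations, so a value of
-- t₂ can be moved to any required one.
module Submission where

open import Level using (0ℓ; lift; lower)
import Algebra.Properties.AbelianGroup as AbelianGroupProperties
import Algebra.Properties.CommutativeSemigroup as CommutativeSemigroupProperties
open import Data.Empty using (⊥)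
open import Data.Integer as ℤ using (ℤ; 0ℤ; 1ℤ; +_; -_; _+_; _-_; ∣_∣)
import Data.Integer.Properties as ℤₚ
open import Data.List using (List; []; _∷_; _++_; map)
import Data.List.Extrema ℤₚ.≤-totalOrder as Extrema
open import Data.List.Membership.Propositional using (find; lose) renaming (_∈_ to _∈ˡ_)
open import Data.List.Membership.Propositional.Properties using (∈-++⁺ˡ; ∈-++⁺ʳ; ∈-map⁺)
import Data.List.Relation.Unary.All as All
import Data.List.Relation.Unary.Any as Any
open import Data.Nat as ℕ using (ℕ; zero; suc; _≟_; z≤n)
import Data.Nat.Properties as ℕₚ
open import Data.Product using (Σ-syntax; ∃-syntax; _×_; _,_; proj₁; proj₂)
open import Data.Sum using (inj₁; inj₂; [_,_]′)
open import Data.Unit using (tt)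
open import Data.Vec using (Vec; []; _∷_)
open import Data.Vec.Relation.Unary.Any using (here; there)
open import Function using (_∘_; _⇔_; mk⇔; module Equivalence)
open import Function.Construct.Composition using (_⇔-∘_)
open import Function.Construct.Symmetry using (⇔-sym)
open import Relation.Binary.PropositionalEquality
  using (_≡_; _≢_; _≗_; refl; sym; trans; cong; cong₂; subst; subst₂; module ≡-Reasoning)
open import Relation.Nullary using (¬_; Dec; yes; no; contradiction)
open import Relation.Nullary.Decidable using (map′; _×-dec_)
open import Relation.Unary using (Pred; U; _∈_; _⊆_; _∪_; ｛_｝)
open import Defs

open Equivalence using (to; from)
open CommutativeSemigroupProperties ℤₚ.+-commutativeSemigroup using (x∙yz≈y∙xz)
open AbelianGroupProperties ℤₚ.+-0-abelianGroup
  using (∙-cancelˡ; ∙-cancelʳ; //-rightDividesˡ; identityˡ-unique; xyx⁻¹≈y; \\-leftDividesʳ)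

-- Finiteness of the set of free variables

module _ {σ : Signature} where

  mutual
    finite-FVᵗ : (t : Term σ) → ∃[ vs ] FVᵗ t ⊆ (_∈ˡ vs)
    finite-FVᵗ (var v)    = v ∷ [] , λ { self → Any.here refl }
    finite-FVᵗ (fun f ts) = let vs , ⊆vs = finite-FV* ts in vs , λ { (arg p) → ⊆vs p }

    finite-FV* : ∀ {n} (ts : Vec (Term σ) n) → ∃[ vs ] FV* ts ⊆ (_∈ˡ vs)
    finite-FV* []       = [] , λ ()
    finite-FV* (t ∷ ts) =
      let vs , ⊆vs = finite-FVᵗ t
          ws , ⊆ws = finite-FV* ts
      in vs ++ ws , λ { (here p) → ∈-++⁺ˡ (⊆vs p) ; (there p) → ∈-++⁺ʳ vs (⊆ws p) }

  finite-∪ : ∀ {P Q : Pred Var 0ℓ} → ∃[ vs ] P ⊆ (_∈ˡ vs) → ∃[ ws ] Q ⊆ (_∈ˡ ws) →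
             ∃[ us ] P ∪ Q ⊆ (_∈ˡ us)
  finite-∪ (vs , ⊆vs) (ws , ⊆ws) = vs ++ ws , [ ∈-++⁺ˡ ∘ ⊆vs , ∈-++⁺ʳ vs ∘ ⊆ws ]′

  -- The game tracks only the variables in such a list. Finiteness guarantees a path that carries no
  -- tracked value.
  finite-FV : ∀ {L} (φ : Formula σ L) → ∃[ vs ] FV φ ⊆ (_∈ˡ vs)
  finite-FV (lit (t ≐ u))     = finite-∪ (finite-FVᵗ t) (finite-FVᵗ u)
  finite-FV (lit (t ≐̸ u))     = finite-∪ (finite-FVᵗ t) (finite-FVᵗ u)
  finite-FV (lit (rel R ts))  = finite-FV* ts
  finite-FV (lit (¬rel R ts)) = finite-FV* ts
  finite-FV (t ⊆ⁱ u)          = finite-∪ (finite-FVᵗ t) (finite-FVᵗ u)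
  finite-FV (φ ∧ᶠ ψ)          = finite-∪ (finite-FV φ) (finite-FV ψ)
  finite-FV (φ ∨ᶠ ψ)          = finite-∪ (finite-FV φ) (finite-FV ψ)
  finite-FV (∃ᶠ v φ)          = let vs , ⊆vs = finite-FV φ in vs , ⊆vs ∘ proj₁
  finite-FV (∀ᶠ v φ)          = let vs , ⊆vs = finite-FV φ in vs , ⊆vs ∘ proj₁
  finite-FV (𝖥 φ)             = finite-FV φ

under-binder-∷ : ∀ {P : Pred Var 0ℓ} {v vs} →
                 (λ w → w ∈ P × v ≢ w) ⊆ (_∈ˡ vs) → P ⊆ (_∈ˡ v ∷ vs)
under-binder-∷ p w∈P with under-binder p w∈P
... | inj₁ w∈vs = Any.there w∈vs
... | inj₂ refl = Any.here refl

≈-refl : ∀ {M D} {s : Assignment M D} → s ≈ s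
≈-refl _ _ = refl

-- The disjoint union of two-way infinite paths

data Edge : ℕ → Set where
  edge : Edge 2

σᴱ : Signature
σᴱ .Fun _ = ⊥
σᴱ .Rel   = Edge

Point : Set
Point = ℤ × ℤ

shift : ℤ → Point → Point
shift k (c , z) = c , k + z

translate : Point → Point → Point
translate (d , k) (c , z) = d + c , k + z

lines : Structure σᴱ
lines .Carrier                 = Point
lines .point                   = 0ℤ , 0ℤ
lines .⟦fun⟧ ()
lines .⟦rel⟧ edge (a ∷ b ∷ []) = b ≡ shift 1ℤ a

shift-shift : ∀ k l a → shift k (shift l a) ≡ shift (k + l) a
shift-shift k l (c , z) = cong (c ,_) (sym (ℤₚ.+-assoc k l z))

shift-identity : ∀ a → shift 0ℤ a ≡ a
shift-identity (c , z) = cong (c ,_) (ℤₚ.+-identityˡ z)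

shift-cancel : ∀ k a → shift (- k) (shift k a) ≡ a
shift-cancel k (c , z) = cong (c ,_) (\\-leftDividesʳ k z)

shift≡⇔≡shift : ∀ k {a b} → shift k a ≡ b ⇔ a ≡ shift (- k) b
shift≡⇔≡shift k {a} {b} = mk⇔
  (λ { refl → sym (shift-cancel k a) })
  (λ { refl → trans (cong (λ j → shift j (shift (- k) b)) (sym (ℤₚ.neg-involutive k)))
                    (shift-cancel (- k) b) })

-- A shift with a fixed point is the shift by zero.
shift-fixed : ∀ k a b → a ≡ shift k a → b ≡ shift k b
shift-fixed k (c , z) b e with identityˡ-unique k z (sym (cong proj₂ e))
... | refl = sym (shift-identity b)

translate-shift : ∀ u k a → translate u (shift k a) ≡ shift k (translate u a)
translate-shift (d , l) k (c , z) = cong (d + c ,_) (x∙yz≈y∙xz l k z)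

translate-comm : ∀ u v a → translate u (translate v a) ≡ translate v (translate u a)
translate-comm (d , k) (e , l) (c , z) = cong₂ _,_ (x∙yz≈y∙xz d e c) (x∙yz≈y∙xz k l z)

translate-injective : ∀ u {a b} → translate u a ≡ translate u b → a ≡ b
translate-injective (d , k) e =
  cong₂ _,_ (∙-cancelˡ d _ _ (cong proj₁ e)) (∙-cancelˡ k _ _ (cong proj₂ e))

translate-transitive : ∀ a b → ∃[ u ] translate u a ≡ b
translate-transitive (c , z) (d , y) =
  (d - c , y - z) , cong₂ _,_ (//-rightDividesˡ c d) (//-rightDividesˡ z y)

Near : ℕ → Point → Point → Set
Near B a b = ∃[ k ] ∣ k ∣ ℕ.≤ B × b ≡ shift k a

near? : ∀ B a b → Dec (Near B a b)
near? B (c , z) (d , y) = map′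
  (λ { (refl , k≤B) → y - z , k≤B , cong (c ,_) (sym (//-rightDividesˡ z y)) })
  (λ { (k , k≤B , refl) → refl , subst (λ j → ∣ j ∣ ℕ.≤ B) (sym (k+z-z≡k k)) k≤B })
  ((c ℤ.≟ d) ×-dec (∣ y - z ∣ ℕ.≤? B))
  where
  k+z-z≡k : ∀ k → k + z - z ≡ k
  k+z-z≡k k = trans (cong (_- z) (ℤₚ.+-comm k z)) (xyx⁻¹≈y z k)

-- The Ehrenfeucht-Fraïssé game on valuations

Valuation : Set
Valuation = Var → Point

update : Valuation → Var → Point → Valuation
update f v m w with v ≟ w
... | yes _ = m
... | no  _ = f w

-- Points of one path farther apart than `B` are not told apart from points of different paths.
record SameGaps (vs : List Var) (B : ℕ) (f g : Valuation) : Set where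
  field
    gap : ∀ {i j} → i ∈ˡ vs → j ∈ˡ vs → ∀ k → ∣ k ∣ ℕ.≤ B →
          f j ≡ shift k (f i) ⇔ g j ≡ shift k (g i)

open SameGaps

SameGaps-sym : ∀ {vs B f g} → SameGaps vs B f g → SameGaps vs B g f
SameGaps-sym f~g .gap i j k k≤B = ⇔-sym (f~g .gap i j k k≤B)

SameGaps-weaken : ∀ {vs B C f g} → B ℕ.≤ C → SameGaps vs C f g → SameGaps vs B f g
SameGaps-weaken B≤C f~g .gap i j k k≤B = f~g .gap i j k (ℕₚ.≤-trans k≤B B≤C)

SameGaps-⊆ : ∀ {vs ws B f g} → (∀ {v} → v ∈ˡ vs → v ∈ˡ ws) →
             SameGaps ws B f g → SameGaps vs B f g
SameGaps-⊆ ⊆ws f~g .gap i j = f~g .gap (⊆ws i) (⊆ws j)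

SameGaps-≗ : ∀ {vs B f f′ g g′} → f ≗ f′ → g ≗ g′ →
             SameGaps vs B f g → SameGaps vs B f′ g′
SameGaps-≗ {f = f} {f′} {g} {g′} f≗f′ g≗g′ f~g .gap {i} {j} i∈vs j∈vs k k≤B =
  rewrite-gap g≗g′ ⇔-∘ (f~g .gap i∈vs j∈vs k k≤B ⇔-∘ ⇔-sym (rewrite-gap f≗f′))
  where
  rewrite-gap : ∀ {h h′ : Valuation} → h ≗ h′ → h j ≡ shift k (h i) ⇔ h′ j ≡ shift k (h′ i)
  rewrite-gap e = mk⇔ (subst₂ (λ a b → b ≡ shift k a) (e i) (e j))
                      (subst₂ (λ a b → b ≡ shift k a) (sym (e i)) (sym (e j)))

-- No gap relates a value of `f` to a value of `g`, so `g` may be moved alone: translations are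
-- injective and commute with shifts.
SameGaps-translate : ∀ {vs B f g} u → SameGaps vs B f g → SameGaps vs B f (translate u ∘ g)
SameGaps-translate {g = g} u f~g .gap i∈vs j∈vs k k≤B =
  mk⇔ (λ e → trans (cong (translate u) e) (translate-shift u k _))
      (λ e → translate-injective u (trans e (sym (translate-shift u k _))))
  ⇔-∘ f~g .gap i∈vs j∈vs k k≤B

SameGaps⇒≡ : ∀ {vs B f g i j} → SameGaps vs B f g → i ∈ˡ vs → j ∈ˡ vs → f i ≡ f j ⇔ g i ≡ g j
SameGaps⇒≡ {f = f} {g} {i} {j} f~g i∈vs j∈vs =
  ⇔-sym (unshift g) ⇔-∘ (f~g .gap i∈vs j∈vs 0ℤ z≤n ⇔-∘ unshift f)
  where
  unshift : ∀ (h : Valuation) → h i ≡ h j ⇔ h j ≡ shift 0ℤ (h i)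
  unshift h = mk⇔ (λ e → trans (sym e) (sym (shift-identity (h i))))
                  (λ e → sym (trans e (shift-identity (h i))))

SameGaps-const : ∀ {vs B} a b → SameGaps vs B (λ _ → a) (λ _ → b)
SameGaps-const a b .gap _ _ k _ = mk⇔ (shift-fixed k a b) (shift-fixed k b a)

SameGaps-update :
  ∀ {vs B f g m m′} v → SameGaps vs B f g →
  (∀ {i} → i ∈ˡ vs → ∀ k → ∣ k ∣ ℕ.≤ B → m ≡ shift k (f i) ⇔ m′ ≡ shift k (g i)) →
  SameGaps (v ∷ vs) B (update f v m) (update g v m′)
SameGaps-update {B = B} {f} {g} {m} {m′} v f~g m~m′ .gap {i} {j} i∈ j∈ k k≤B with v ≟ i | v ≟ j
... | yes _   | yes _   = mk⇔ (shift-fixed k m m′) (shift-fixed k m′ m)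
... | no v≢i  | yes _   = m~m′ (Any.tail (v≢i ∘ sym) i∈) k k≤B
... | no v≢i  | no v≢j  = f~g .gap (Any.tail (v≢i ∘ sym) i∈) (Any.tail (v≢j ∘ sym) j∈) k k≤B
-- The gap from the new value to an old one is the opposite gap, by `- k`, from the old value to the
-- new one.
... | yes _   | no v≢j  =
  flip-shift g m′ ⇔-∘
  (m~m′ (Any.tail (v≢j ∘ sym) j∈) (- k) (subst (ℕ._≤ B) (sym (ℤₚ.∣-i∣≡∣i∣ k)) k≤B)
    ⇔-∘ ⇔-sym (flip-shift f m))
  where
  flip-shift : ∀ (h : Valuation) a → a ≡ shift (- k) (h j) ⇔ h j ≡ shift k a
  flip-shift h a = mk⇔ sym sym ⇔-∘ ⇔-sym (shift≡⇔≡shift k)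

fresh : (xs : List ℤ) → ∃[ c ] (∀ {x} → x ∈ˡ xs → c ≢ x)
fresh xs = ℤ.suc (Extrema.max 0ℤ xs) , λ x∈xs c≡x →
  ℤₚ.<⇒≢ (ℤₚ.≤-<-trans (All.lookup (Extrema.xs≤max 0ℤ xs) x∈xs)
                        (ℤₚ.suc[i]≤j⇒i<j ℤₚ.≤-refl)) (sym c≡x)

-- The answer to a move `m`. If `m` lies at displacement `l` of size at most `B` from a tracked
-- `f i₀`, the answer copies `l` from `g i₀`; a gap `k` to `m` then becomes a gap `- l + k` to
-- `f i₀`, which the bound `B + B` covers. If no tracked value is near, the answer goes to a fresh
-- path.
SameGaps-extend : ∀ {vs B f g} v → SameGaps vs (B ℕ.+ B) f g → ∀ m →
                  ∃[ m′ ] SameGaps (v ∷ vs) B (update f v m) (update g v m′)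
SameGaps-extend {vs} {B} {f} {g} v f~g m with Any.any? (λ i → near? B (f i) m) vs
... | yes near with find near
...   | i₀ , i₀∈vs , l , l≤B , refl =
  shift l (g i₀) , SameGaps-update v (SameGaps-weaken (ℕₚ.m≤m+n B B) f~g) λ {i} i∈vs k k≤B →
    ⇔-sym (regroup g i k) ⇔-∘ (f~g .gap i∈vs i₀∈vs (- l + k) (∣-l+k∣≤B+B k k≤B) ⇔-∘ regroup f i k)
  where
  regroup : ∀ (h : Valuation) i k →
            shift l (h i₀) ≡ shift k (h i) ⇔ h i₀ ≡ shift (- l + k) (h i)
  regroup h i k = mk⇔ (λ e → trans e (shift-shift (- l) k (h i)))
                      (λ e → trans e (sym (shift-shift (- l) k (h i))))
                  ⇔-∘ shift≡⇔≡shift l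

  ∣-l+k∣≤B+B : ∀ k → ∣ k ∣ ℕ.≤ B → ∣ - l + k ∣ ℕ.≤ B ℕ.+ B
  ∣-l+k∣≤B+B k k≤B = ℕₚ.≤-trans (ℤₚ.∣i+j∣≤∣i∣+∣j∣ (- l) k)
    (ℕₚ.+-mono-≤ (subst (ℕ._≤ B) (sym (ℤₚ.∣-i∣≡∣i∣ l)) l≤B) k≤B)
SameGaps-extend {vs} {B} {f} {g} v f~g m | no ¬near =
  -- Both sides of each equivalence fail: `m` is not near any tracked value of `f`, and the path `c`
  -- contains no tracked value of `g`.
  let c , c∉ = fresh (map (proj₁ ∘ g) vs) in
  (c , 0ℤ) , SameGaps-update v (SameGaps-weaken (ℕₚ.m≤m+n B B) f~g) λ i∈vs k k≤B →
    mk⇔ (λ e → contradiction (lose i∈vs (k , k≤B , e)) ¬near)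
        (λ e → contradiction (cong proj₁ e) (c∉ (∈-map⁺ (proj₁ ∘ g) i∈vs)))

-- Bisimilar teams and translation invariance

-- The gap bound needed to transfer a formula. An edge is a gap of 1; a quantifier doubles the
-- bound, because answering a move halves it; the sum for a connective bounds the ranks of both
-- parts.
rank : ∀ {L} → Formula σᴱ L → ℕ
rank (lit α)  = 1
rank (t ⊆ⁱ u) = 1
rank (φ ∧ᶠ ψ) = rank φ ℕ.+ rank ψ
rank (φ ∨ᶠ ψ) = rank φ ℕ.+ rank ψ
rank (∃ᶠ v φ) = rank φ ℕ.+ rank φ
rank (∀ᶠ v φ) = rank φ ℕ.+ rank φ
rank (𝖥 φ)    = rank φ

extend-total : ∀ {D : Pred Var 0ℓ} {v} → (∀ w → w ∈ D) → ∀ w → w ∈ D ∪ ｛ v ｝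
extend-total total w = inj₁ (total w)

module _ {D : Pred Var 0ℓ} (total : ∀ w → w ∈ D) where

  valuation : Assignment Point D → Valuation
  valuation s w = s w (total w)

  valuation-[/] : ∀ s v m → update (valuation s) v m ≗ λ w → (s [ m / v ]) w (inj₁ (total w))
  valuation-[/] s v m w with v ≟ w
  ... | yes _ = refl
  ... | no  _ = refl

  -- Literals transfer by `back` alone; for an inclusion atom, `forth` then carries the witness to
  -- the second team.
  record Bisimilar (vs : List Var) (B : ℕ) (X Y : Team Point D) : Set where
    field
      forth : ∀ {s} → s ∈ᵀ X → ∃[ t ] t ∈ᵀ Y × SameGaps vs B (valuation s) (valuation t)
      back  : ∀ {t} → t ∈ᵀ Y → ∃[ s ] s ∈ᵀ X × SameGaps vs B (valuation s) (valuation t)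

open Bisimilar

Bisimilar-weaken : ∀ {D} {total : ∀ w → w ∈ D} {vs B C X Y} → B ℕ.≤ C →
                   Bisimilar total vs C X Y → Bisimilar total vs B X Y
Bisimilar-weaken B≤C X~Y .forth s∈X = let t , t∈Y , s~t = X~Y .forth s∈X in
  t , t∈Y , SameGaps-weaken B≤C s~t
Bisimilar-weaken B≤C X~Y .back t∈Y = let s , s∈X , s~t = X~Y .back t∈Y in
  s , s∈X , SameGaps-weaken B≤C s~t

move : ∀ {D} → Point → Assignment Point D → Assignment Point D
move u s w p = translate u (s w p)

move-[/] : ∀ {D} u (s : Assignment Point D) m v →
           move u (s [ m / v ]) ≈ move u s [ translate u m / v ]
move-[/] u s m v w p with v ≟ w
... | yes _ = refl
... | no  _ = refl

-- `SameGaps` compares values within one assignment, whereas an inclusion atom compares values of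
-- two assignments of a team. Invariance closes this gap, and only the team to which truth is
-- transferred must have it.
Invariant : ∀ {D} → Team Point D → Set
Invariant Y = ∀ u {t} → t ∈ᵀ Y → move u t ∈ᵀ Y

[/]-cong : ∀ {D} {s t : Assignment Point D} m v → s ≈ t → s [ m / v ] ≈ t [ m / v ]
[/]-cong m v s≈t w p with v ≟ w
... | yes _   = refl
... | no  v≢w = s≈t w _

-- Bisimilarity and invariance under disjunction and quantifiers

module Transfer {D : Pred Var 0ℓ} (total : ∀ w → w ∈ D) where

  private
    val : Assignment Point D → Valuation
    val = valuation total

  module Disjunct (vs : List Var) (B : ℕ) (Y : Team Point D) (Yinv : Invariant Y) where

    -- Taking all matches in `Y`, rather than one for each member of `X`, keeps the disjunct's team
    -- closed under translations.
    image : Team Point D → Team Point D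
    image X .member t = t ∈ᵀ Y × ∃[ s ] s ∈ᵀ X × SameGaps vs B (val s) (val t)
    image X .resp t≈u (t∈Y , s , s∈X , s~t) =
      Y .resp t≈u t∈Y , s , s∈X , SameGaps-≗ (λ _ → refl) (λ w → t≈u w (total w)) s~t

    image-invariant : ∀ X → Invariant (image X)
    image-invariant X u (t∈Y , s , s∈X , s~t) = Yinv u t∈Y , s , s∈X , SameGaps-translate u s~t

    image-bisimilar : ∀ {X X′} → (∀ {s} → s ∈ᵀ X′ → s ∈ᵀ X) → Bisimilar total vs B X Y →
                      Bisimilar total vs B X′ (image X′)
    image-bisimilar X′⊆X X~Y .forth {s} s∈X′ = let t , t∈Y , s~t = X~Y .forth (X′⊆X s∈X′) in
      t , (t∈Y , s , s∈X′ , s~t) , s~t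
    image-bisimilar X′⊆X X~Y .back (_ , s∈X′) = s∈X′

    image-union : ∀ {X X₁ X₂} → IsUnion X X₁ X₂ → Bisimilar total vs B X Y →
                  IsUnion Y (image X₁) (image X₂)
    image-union X≡ X~Y t = mk⇔
      (λ t∈Y → let s , s∈X , s~t = X~Y .back t∈Y in
        [ (λ s∈X₁ → inj₁ (t∈Y , s , s∈X₁ , s~t))
        , (λ s∈X₂ → inj₂ (t∈Y , s , s∈X₂ , s~t)) ]′ (X≡ s .to s∈X))
      [ proj₁ , proj₁ ]′

  module Quantifier {vs B X Y} (X~Y : Bisimilar total vs (B ℕ.+ B) X Y) (Yinv : Invariant Y)
                    (v : Var) where

    private
      val⁺ : Assignment Point (D ∪ ｛ v ｝) → Valuation
      val⁺ = valuation (extend-total total)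

      _≃_ : Assignment Point (D ∪ ｛ v ｝) → Assignment Point (D ∪ ｛ v ｝) → Set
      s ≃ t = SameGaps (v ∷ vs) B (val⁺ s) (val⁺ t)

      ≃-resp : ∀ {s s′ t t′} → s ≈ s′ → t ≈ t′ → s ≃ t → s′ ≃ t′
      ≃-resp s≈s′ t≈t′ =
        SameGaps-≗ (λ w → s≈s′ w (inj₁ (total w))) (λ w → t≈t′ w (inj₁ (total w)))

      answer : ∀ {s t} → SameGaps vs (B ℕ.+ B) (val s) (val t) →
               ∀ m → ∃[ m′ ] (s [ m / v ]) ≃ (t [ m′ / v ])
      answer {s} {t} s~t m = let m′ , e = SameGaps-extend v s~t m in
        m′ , SameGaps-≗ (valuation-[/] total s v m) (valuation-[/] total t v m′) e

    duplicate-bisimilar : Bisimilar (extend-total total) (v ∷ vs) B (duplicate X v) (duplicate Y v)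
    duplicate-bisimilar .forth {u} (s , m , s∈X , u≈) =
      let t , t∈Y , s~t = X~Y .forth s∈X
          m′ , e        = answer s~t m
      in t [ m′ / v ] , (t , m′ , t∈Y , ≈-refl) , ≃-resp (≈-sym u≈) ≈-refl e
    duplicate-bisimilar .back {u} (t , m , t∈Y , u≈) =
      let s , s∈X , s~t = X~Y .back t∈Y
          -- The new point is given on the side of `Y`, so the roles in the game are exchanged.
          m′ , e        = answer (SameGaps-sym s~t) m
      in s [ m′ / v ] , (s , m′ , s∈X , ≈-refl) ,
         ≃-resp ≈-refl (≈-sym u≈) (SameGaps-sym e)

    duplicate-invariant : Invariant (duplicate Y v)
    duplicate-invariant u (t , m , t∈Y , e) =
      move u t , translate u m , Yinv u t∈Y ,
      ≈-trans (λ w p → cong (translate u) (e w p)) (move-[/] u t m v)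

    module _ (H : Supplement X) where

      transport : Supplement Y
      transport .choice t m′ =
        ∃[ s ] ∃[ m ] s ∈ᵀ X × m ∈ choice H s × (s [ m / v ]) ≃ (t [ m′ / v ])
      transport .coherent t∈Y t≈t′ {m′} (s , m , s∈X , m∈H , e) =
        s , m , s∈X , m∈H , ≃-resp ≈-refl ([/]-cong m′ v t≈t′) e
      transport .nonempty t∈Y =
        let s , s∈X , s~t = X~Y .back t∈Y
            m , m∈H       = H .nonempty s∈X
            m′ , e        = answer s~t m
        in m′ , s , m , s∈X , m∈H , e

      supplement-bisimilar : Bisimilar (extend-total total) (v ∷ vs) B
                                       (supplement X H v) (supplement Y transport v)
      supplement-bisimilar .forth {u} (s , m , s∈X , m∈H , u≈) =
        let t , t∈Y , s~t = X~Y .forth s∈X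
            m′ , e        = answer s~t m
        in t [ m′ / v ] , (t , m′ , t∈Y , (s , m , s∈X , m∈H , e) , ≈-refl) ,
           ≃-resp (≈-sym u≈) ≈-refl e
      supplement-bisimilar .back (t , m′ , t∈Y , (s , m , s∈X , m∈H , e) , u≈) =
        s [ m / v ] , (s , m , s∈X , m∈H , ≈-refl) , ≃-resp ≈-refl (≈-sym u≈) e

      supplement-invariant : Invariant (supplement Y transport v)
      supplement-invariant u (t , m′ , t∈Y , (s , m , s∈X , m∈H , e) , ≈t) =
        move u t , translate u m′ , Yinv u t∈Y ,
        (s , m , s∈X , m∈H ,
          ≃-resp ≈-refl (move-[/] u t m′ v) (SameGaps-translate u e)) ,
        ≈-trans (λ w p → cong (translate u) (≈t w p)) (move-[/] u t m′ v)

  -- All terms are variables, as `σᴱ` has no function symbols. Equality is gap 0 and an edge is gap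
  -- 1, so bound 1 suffices.
  literal-transfer : ∀ {vs s t} α (p : FVˡ α ⊆ (_∈ˡ vs)) .(q : FVˡ α ⊆ D) →
                     SameGaps vs 1 (val s) (val t) → Satˡ lines s α q → Satˡ lines t α q
  literal-transfer (var x ≐ var y) p q s~t =
    SameGaps⇒≡ s~t (p (inj₁ self)) (p (inj₂ self)) .to
  literal-transfer (var x ≐̸ var y) p q s~t =
    _∘ SameGaps⇒≡ s~t (p (inj₁ self)) (p (inj₂ self)) .from
  literal-transfer (rel edge (var x ∷ var y ∷ [])) p q s~t =
    s~t .gap (p (here self)) (p (there (here self))) 1ℤ ℕₚ.≤-refl .to
  literal-transfer (¬rel edge (var x ∷ var y ∷ [])) p q s~t =
    _∘ s~t .gap (p (here self)) (p (there (here self))) 1ℤ ℕₚ.≤-refl .from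

open Transfer

-- Induction on `ψ`, rebuilding an invariant second team at each disjunction and quantifier. This
-- breaks down for `𝖥`, since a singleton team is not invariant.
transfer : ∀ {vs} (ψ : Formula σᴱ FO⊆₁) → FV ψ ⊆ (_∈ˡ vs) →
           ∀ {D} (total : ∀ w → w ∈ D) (q : FV ψ ⊆ D) {X Y} →
           Bisimilar total vs (rank ψ) X Y → Invariant Y → Sat lines X ψ q → Sat lines Y ψ q
transfer (lit α) p total q X~Y Yinv h t t∈Y =
  let s , s∈X , s~t = X~Y .back t∈Y in lift (literal-transfer total α p q s~t (h s s∈X .lower))
transfer (var x ⊆ⁱ var y) p total q {X} {Y} X~Y Yinv h t t∈Y =
  let s , s∈X , s~t             = X~Y .back t∈Y
      lift (s′ , s′∈X , sx≡s′y) = h s s∈X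
      t′ , t′∈Y , _             = X~Y .forth s′∈X
      -- The partner `t′` of the witness may have the wrong value at `y`; a translation corrects it
      -- without leaving `Y`.
      u , ut′y≡tx               = translate-transitive (valuation total t′ y) (valuation total t x)
  in lift (move u t′ , Yinv u t′∈Y , sym ut′y≡tx)
transfer (φ ∧ᶠ ψ) p total q X~Y Yinv (hφ , hψ) =
  transfer φ (p ∘ inj₁) total (q ∘ inj₁)
    (Bisimilar-weaken (ℕₚ.m≤m+n (rank φ) (rank ψ)) X~Y) Yinv hφ ,
  transfer ψ (p ∘ inj₂) total (q ∘ inj₂)
    (Bisimilar-weaken (ℕₚ.m≤n+m (rank ψ) (rank φ)) X~Y) Yinv hψ
transfer {vs} (φ ∨ᶠ ψ) p total q {X} {Y} X~Y Yinv (X₁ , X₂ , X≡ , hφ , hψ) =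
  image X₁ , image X₂ , image-union {X} {X₁} {X₂} X≡ X~Y ,
  transfer φ (p ∘ inj₁) total (q ∘ inj₁)
    (Bisimilar-weaken (ℕₚ.m≤m+n (rank φ) (rank ψ))
      (image-bisimilar (λ {s} → X≡ s .from ∘ inj₁) X~Y))
    (image-invariant X₁) hφ ,
  transfer ψ (p ∘ inj₂) total (q ∘ inj₂)
    (Bisimilar-weaken (ℕₚ.m≤n+m (rank ψ) (rank φ))
      (image-bisimilar (λ {s} → X≡ s .from ∘ inj₂) X~Y))
    (image-invariant X₂) hψ
  where open Disjunct total vs (rank φ ℕ.+ rank ψ) Y Yinv
transfer (∃ᶠ v φ) p total q X~Y Yinv (H , h) =
  transport H ,
  transfer φ (under-binder-∷ p) (extend-total total) (under-binder q)
    (supplement-bisimilar H) (supplement-invariant H) h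
  where open Quantifier total {B = rank φ} X~Y Yinv v
transfer (∀ᶠ v φ) p total q X~Y Yinv h =
  transfer φ (under-binder-∷ p) (extend-total total) (under-binder q)
    duplicate-bisimilar duplicate-invariant h
  where open Quantifier total {B = rank φ} X~Y Yinv v

-- The formula that separates the teams

-- On a singleton team: there is an infinite path from v₁ avoiding v₀.
avoiding : Formula σᴱ FO⊆₁F
avoiding = ∃ᶠ 2 ((var 1 ⊆ⁱ var 2) ∧ᶠ (lit (var 2 ≐̸ var 0) ∧ᶠ
             ∃ᶠ 3 (lit (rel edge (var 2 ∷ var 3 ∷ [])) ∧ᶠ (var 3 ⊆ⁱ var 2))))

-- Variable 2 takes all values on the path of variable 1. This set contains the starting point, is
-- closed under successor, and misses variable 0, which lies on another path.
avoiding-distinct-lines : ∀ (s : Assignment Point U) → proj₁ (s 0 tt) ≢ proj₁ (s 1 tt) →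
                          Sat lines (singleton s) avoiding (λ _ → tt)
avoiding-distinct-lines s distinct = H , start , avoids , next , step , stays
  where
  H : Supplement (singleton s)
  H .choice _ m     = proj₁ m ≡ proj₁ (s 1 tt)
  H .coherent _ _ e = e
  H .nonempty _     = s 1 tt , refl

  X₂ = supplement (singleton s) H 2

  next : Supplement X₂
  next .choice u m        = m ≡ shift 1ℤ (u 2 (inj₂ refl))
  next .coherent _ e refl = cong (shift 1ℤ) (e 2 _)
  next .nonempty _        = _ , refl

  X₃ = supplement X₂ next 3

  start : Sat lines {FO⊆₁F} X₂ (var 1 ⊆ⁱ var 2) (λ _ → inj₁ tt)
  start u (s′ , _ , s′≈s , _ , u≈) = lift
    ( s [ s 1 tt / 2 ]
    , (s , s 1 tt , ≈-refl , refl , ≈-refl)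
    , trans (u≈ 1 _) (s′≈s 1 tt))

  avoids : Sat lines {FO⊆₁F} X₂ (lit (var 2 ≐̸ var 0)) (λ _ → inj₁ tt)
  avoids u (s′ , m , s′≈s , m∈H , u≈) = lift λ u2≡u0 → distinct (begin
    proj₁ (s 0 tt)  ≡⟨ cong proj₁ (s′≈s 0 tt) ⟨
    proj₁ (s′ 0 tt) ≡⟨ cong proj₁ (u≈ 0 _) ⟨
    proj₁ (u 0 _)   ≡⟨ cong proj₁ u2≡u0 ⟨
    proj₁ (u 2 _)   ≡⟨ cong proj₁ (u≈ 2 _) ⟩
    proj₁ m         ≡⟨ m∈H ⟩
    proj₁ (s 1 tt)  ∎)
    where open ≡-Reasoning

  step : Sat lines {FO⊆₁F} X₃ (lit (rel edge (var 2 ∷ var 3 ∷ []))) (λ _ → inj₁ (inj₁ tt))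
  step z (u , _ , _ , refl , z≈) = lift (trans (z≈ 3 _) (cong (shift 1ℤ) (sym (z≈ 2 _))))

  stays : Sat lines {FO⊆₁F} X₃ (var 3 ⊆ⁱ var 2) (λ _ → inj₁ (inj₁ tt))
  stays z (u , m , (_ , _ , _ , m′∈H , u≈) , refl , z≈) = lift
    ( (s [ m / 2 ]) [ shift 1ℤ m / 3 ]
    , ( s [ m / 2 ]
      , shift 1ℤ m
      , (s , m , ≈-refl , trans (cong proj₁ (u≈ 2 _)) m′∈H , ≈-refl)
      , refl
      , ≈-refl)
    , z≈ 3 _)

-- The values of variable 2 include that of variable 1 and are closed under successor, so after `n`
-- steps they include that of variable 0.
avoiding-reachable : ∀ (s : Assignment Point U) n → s 0 tt ≡ shift (+ n) (s 1 tt) →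
                     ¬ Sat lines (singleton s) avoiding (λ _ → tt)
avoiding-reachable s n s0≡ (H , start , avoids , next , step , stays) =
  let u , u∈ , u2≡           = visited n
      s′ , _ , s′≈s , _ , u≈ = u∈
  in avoids u u∈ .lower (begin
    u 2 _                 ≡⟨ u2≡ ⟩
    shift (+ n) (s 1 tt)  ≡⟨ s0≡ ⟨
    s 0 tt                ≡⟨ s′≈s 0 tt ⟨
    s′ 0 tt               ≡⟨ u≈ 0 _ ⟨
    u 0 _                 ∎)
  where
  open ≡-Reasoning

  visited : ∀ n → ∃[ u ] u ∈ᵀ supplement (singleton s) H 2 ×
                         u 2 (inj₂ refl) ≡ shift (+ n) (s 1 tt)
  visited zero =
    let m , m∈H = H .nonempty {s} ≈-refl
        lift (u , u∈ , s1≡u2) = start (s [ m / 2 ]) (s , m , ≈-refl , m∈H , ≈-refl)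
    in u , u∈ , trans (sym s1≡u2) (sym (shift-identity (s 1 tt)))
  visited (suc n) =
    let u , u∈ , u2≡ = visited n
        m , m∈       = next .nonempty u∈
        z∈           = u , m , u∈ , m∈ , ≈-refl
        -- The atom finds the successor `m` as a value of variable 2 in the team extended by
        -- variable 3; `u′` is the underlying assignment before that extension.
        lift (z′ , (u′ , m′ , u′∈ , _ , z′≈) , m≡z′2) = stays (u [ m / 3 ]) z∈
    in u′ , u′∈ , (begin
      u′ 2 _                           ≡⟨ z′≈ 2 _ ⟨
      z′ 2 _                           ≡⟨ m≡z′2 ⟨
      m                                ≡⟨ step (u [ m / 3 ]) z∈ .lower ⟩
      shift 1ℤ (u 2 _)                 ≡⟨ cong (shift 1ℤ) u2≡ ⟩
      shift 1ℤ (shift (+ n) (s 1 tt))  ≡⟨ shift-shift 1ℤ (+ n) (s 1 tt) ⟩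
      shift (+ suc n) (s 1 tt)         ∎)

-- The two teams

displacement : Point → Point → Assignment Point U
displacement d a v _ = update (λ _ → a) 0 (translate d a) v

-- The variables other than v₀ and v₁ are present because a candidate formula may
-- mention them; they share the value of v₁.
displaced : Point → Team Point U
displaced d .member s          = ∃[ a ] s ≈ displacement d a
displaced d .resp s≈t (a , s≈) = a , ≈-trans (≈-sym s≈t) s≈

-- Translations commute, so moving an assignment only moves its base point `a`.
displaced-invariant : ∀ d → Invariant (displaced d)
displaced-invariant d u (a , t≈) = translate u a , λ v p →
  trans (cong (translate u) (t≈ v p)) (move-displacement v)
  where
  move-displacement : ∀ v → translate u (displacement d a v tt) ≡
                            displacement d (translate u a) v tt
  move-displacement zero    = translate-comm u d a
  move-displacement (suc _) = refl

-- Assignments with the same base point are matched. They differ only at variable 0, whose gaps to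
-- the other variables exceed `B` or do not exist on either side.
displaced-bisimilar : ∀ {vs B} d e →
  (∀ a → ¬ Near B a (translate d a)) → (∀ a → ¬ Near B a (translate e a)) →
  Bisimilar (λ _ → tt) vs B (displaced d) (displaced e)
displaced-bisimilar {vs} {B} d e far-d far-e = record
  { forth = λ { (a , s≈) → displacement e a , (a , ≈-refl) ,
                SameGaps-≗ (λ w → sym (s≈ w tt)) (λ _ → refl) (same a) }
  ; back  = λ { (a , s≈) → displacement d a , (a , ≈-refl) ,
                SameGaps-≗ (λ _ → refl) (λ w → sym (s≈ w tt)) (same a) }
  }
  where
  same : ∀ a → SameGaps vs B (λ v → displacement d a v tt) (λ v → displacement e a v tt)
  -- The update adds 0 to the list of variables whether or not it occurs in `vs`; the result is then
  -- restricted to `vs`.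
  same a = SameGaps-⊆ Any.there (SameGaps-update 0 (SameGaps-const a a) λ _ k k≤B →
    mk⇔ (λ eq → contradiction (k , k≤B , eq) (far-d a))
        (λ eq → contradiction (k , k≤B , eq) (far-e a)))

other-line-far : ∀ B a → ¬ Near B a (translate (1ℤ , 0ℤ) a)
other-line-far B (c , z) (k , _ , eq) = ℤₚ.i≢suc[i] (sym (cong proj₁ eq))

same-line-far : ∀ B a → ¬ Near B a (translate (0ℤ , + suc B) a)
same-line-far B (c , z) (k , k≤B , eq) with ∙-cancelʳ z (+ suc B) k (cong proj₂ eq)
... | refl = ℕₚ.1+n≰n k≤B

corollary5p5 : Σ[ σ ∈ Signature ] Σ[ φ ∈ Formula σ FO⊆₁F ] (∀ (ψ : Formula σ FO⊆₁) → ¬ Equivalent φ ψ)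
corollary5p5 = σᴱ , 𝖥 avoiding , λ ψ equiv →
  let vs , ⊆vs = finite-FV ψ
      -- The least distance that the game for `ψ` cannot detect. Only this team depends on `ψ`; the
      -- flattened formula and `X` are fixed.
      N        = suc (rank ψ)
      X        = displaced (1ℤ , 0ℤ)
      Y        = displaced (0ℤ , + N)
      φ⇔ψ      = equiv lines U (λ _ → tt) (λ _ → tt)
      X⊨φ      = λ s (a , s≈) → avoiding-distinct-lines s λ eq → ℤₚ.i≢suc[i]
                   (sym (trans (sym (cong proj₁ (s≈ 0 tt))) (trans eq (cong proj₁ (s≈ 1 tt)))))
      Y⊨ψ      = transfer ψ ⊆vs (λ _ → tt) (λ _ → tt)
                   (displaced-bisimilar (1ℤ , 0ℤ) (0ℤ , + N)
                     (other-line-far (rank ψ)) (same-line-far (rank ψ)))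
                   (displaced-invariant (0ℤ , + N)) (φ⇔ψ X .to X⊨φ)
      a        = lines .point
  -- By flattening, one member of `Y` suffices for the contradiction: its variable 0 is reached from
  -- its variable 1 in `N` steps.
  in avoiding-reachable (displacement (0ℤ , + N) a) N refl
       (φ⇔ψ Y .from Y⊨ψ (displacement (0ℤ , + N) a) (a , ≈-refl))
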